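{- For every $C>0$ there exists $c>0$ such that the following holds. If $d\geq 2$ is an integer and $D$ is a finite $(C,d)$-regular digraph with girth $g$, then $D$ contains a directed path of length at least $\frac{c\,d\,g}{\log d}$.
   Context: A digraph $D$ is $(C,d)$-regular if $d^+(v)\geq d$ and $d^-(v)\leq Cd$ for every vertex $v$ (out-degree and in-degree respectively). The girth is the minimum length of a directed cycle. Path length counts arcs. -}

module Defs where

open import Data.Nat using (ℕ; zero; suc; _≤_; _<_; _*_; _+_)
open import Data.Fin using (Fin; zero; suc; inject₁; fromℕ)
open import Data.Bool using (Bool; true; false; if_then_else_; T)
open import Data.List using (List; map; allFin)
open import Data.Nat.ListAction using (sum)
open import Data.Empty using (⊥)
open import Data.Integer using (+_)
open import Data.Rational using (ℚ; _/_) renaming (_≤_ to _≤ℚ_; _*_ to _*ℚ_)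
open import Data.Product using (Σ; _×_; ∃)
open import Function.Definitions using (Injective)
open import Relation.Binary.PropositionalEquality using (_≡_)

record Digraph (n : ℕ) : Set where
  field
    arc : Fin n → Fin n → Bool
open Digraph public

ℕtoℚ : ℕ → ℚ
ℕtoℚ k = + k / 1

outdeg : ∀ {n} → Digraph n → Fin n → ℕ
outdeg {n} D v = sum (map (λ w → if arc D v w then 1 else 0) (allFin n))

indeg : ∀ {n} → Digraph n → Fin n → ℕ
indeg {n} D v = sum (map (λ u → if arc D u v then 1 else 0) (allFin n))

Regular : ∀ {n} → ℚ → ℕ → Digraph n → Set
Regular C d D = ∀ v → (d ≤ outdeg D v) × (ℕtoℚ (indeg D v) ≤ℚ C *ℚ ℕtoℚ d)

IsPath : ∀ {n} → Digraph n → (L : ℕ) → (Fin (suc L) → Fin n) → Set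
IsPath D L p = Injective _≡_ _≡_ p × (∀ (i : Fin L) → T (arc D (p (inject₁ i)) (p (suc i))))

HasPath : ∀ {n} → Digraph n → ℕ → Set
HasPath {n} D L = Σ (Fin (suc L) → Fin n) (IsPath D L)

IsCycle : ∀ {n} → Digraph n → (m : ℕ) → (Fin (suc m) → Fin n) → Set
IsCycle D m p = Injective _≡_ _≡_ p
  × (∀ (i : Fin m) → T (arc D (p (inject₁ i)) (p (suc i))))
  × T (arc D (p (fromℕ m)) (p zero))

HasCycleOfLength : ∀ {n} → Digraph n → ℕ → Set
HasCycleOfLength D zero = ⊥
HasCycleOfLength {n} D (suc m) = Σ (Fin (suc m) → Fin n) (IsCycle D m)

Girth : ∀ {n} → Digraph n → ℕ → Set
Girth D g = HasCycleOfLength D g × (∀ k → HasCycleOfLength D k → g ≤ k)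

{-# OPTIONS --safe #-}
module Submission where

-- Let k be about d / log d. Keep exactly d out-arcs at every vertex and colour the vertices uniformly at
-- random with k colours. The event that some colour is missing among the kept out-neighbours of v has
-- probability at most k (1 - 1/k)^d and is independent of all such events but those of the at most C d²
-- vertices that share a kept out-neighbour with v. So by the Lovász local lemma some colouring gives every
-- vertex an out-neighbour of every colour. Now walk through g vertices of the first colour, then g vertices
-- of the second one, and so on. Two equal vertices of the walk would have the same colour, hence be less
-- than g steps apart and close a cycle shorter than g. So the walk is a path with k g vertices.

open import Defs
open import Data.Bool using (true; false; T; if_then_else_)
open import Data.Fin using (Fin; zero; suc; toℕ; _↑ˡ_; _↑ʳ_; combine; finToFun)
open import Data.Fin.Properties using (toℕ-inject₁; toℕ-fromℕ; toℕ-fromℕ<; toℕ<n; toℕ-injective; any?; remQuot-combine) renaming (_≟_ to _≟ᶠ_)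
open import Data.Fin.Subset using (Subset; _∈_; inside; outside)
open import Data.Fin.Subset.Properties using (_∈?_)
open import Data.Integer as ℤ using (-[1+_]; ∣_∣)
import Data.Integer.Properties as ℤ
open import Data.List as List using (List; []; _∷_; length; lookup; filter; allFin)
open import Data.List.Membership.Propositional using (lose) renaming (_∈_ to _∈ᴸ_)
open import Data.List.Membership.Propositional.Properties using (∈-allFin; ∈-filter⁻; ∈-lookup)
open import Data.List.Properties using (filter-notAll; map-tabulate)
open import Data.List.Relation.Binary.Sublist.Propositional using (⊆-refl; _∷ʳ_) renaming (_⊆_ to _⊆ᴸ_)
open import Data.List.Relation.Binary.Sublist.Propositional.Properties using (filter-⊆; length-mono-≤) renaming (filter⁺ to ⊆-filter⁺)
open import Data.List.Relation.Unary.All as All using (All; []; _∷_)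
open import Data.List.Relation.Unary.All.Properties using (all-filter; filter⁺; filter⁻; ¬Any⇒All¬)
open import Data.List.Relation.Unary.Any as Any using (Any)
open import Data.List.Relation.Unary.Any.Properties using (lookup-index)
open import Data.Nat using (ℕ; zero; suc; _+_; _*_; _∸_; _^_; _≤_; _<_; ⌊_/2⌋; ⌈_/2⌉; NonZero; >-nonZero; >-nonZero⁻¹; z≤n; s≤s; z<s)
open import Data.Nat.DivMod using (_/_; _%_; _mod_; m≡m%n+[m/n]*n; m%n<n; m/n*n≤m; m/n<m; m<n⇒m%n≡m; m<n*o⇒m/o<n)
open import Data.Nat.Induction using (Acc; acc; <-rec; <-wellFounded)
open import Data.Nat.ListAction using () renaming (sum to sumᴸ)
open import Data.Nat.Logarithm using (⌊log₂_⌋; ⌊log₂⌋-mono-≤; ⌊log₂[2^n]⌋≡n; ⌊log₂⌊n/2⌋⌋≡⌊log₂n⌋∸1)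
open import Data.Nat.Properties
open import Data.Nat.Tactic.RingSolver using (solve-∀)
open import Data.Product using (Σ; ∃; _×_; _,_; proj₁; proj₂; map₁; map₂; uncurry)
open import Data.Rational as ℚ using (ℚ; 0ℚ; ↥_) renaming (_<_ to _<ℚ_)
import Data.Rational.Properties as ℚ
open import Data.Rational.Unnormalised as ℚᵘ using (mkℚᵘ; ↧ₙ_)
import Data.Rational.Unnormalised.Properties as ℚᵘ
open import Data.Sum using (_⊎_; inj₁; inj₂)
open import Data.Vec as Vec using (_∷_; here; there) renaming ([] to []ᵛ)
open import Data.Vec.Functional using () renaming (_∷_ to _∷ᶠ_)
open import Function using (_∘_; id; case_of_)
open import Function.Definitions using (Injective)
open import Level using (0ℓ)
open import Relation.Binary using (Rel; _Respects_; tri<; tri≈; tri>) renaming (Decidable to Decidable₂)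
open import Relation.Binary.PropositionalEquality using (_≡_; _≢_; _≗_; refl; sym; trans; cong; cong₂; subst; subst₂; module ≡-Reasoning)
open import Relation.Nullary using (¬_; Dec; yes; no; does; ¬?; contradiction; _×-dec_; _⊎-dec_)
open import Relation.Nullary.Decidable using (T?; decidable-stable)
open import Relation.Unary using (Pred; Decidable; _⊆_; _∩_; _≐_; ∁)
open import Relation.Unary.Properties using (_∩?_; _∪?_; ∁?)
open import Algebra.Properties.Semiring.Sum +-*-semiring using (sum; sum-cong-≗; sum-replicate-zero; ∑-distrib-+; ∑-comm; *-distribˡ-sum; *-distribʳ-sum)

-- Powers, logarithms and quotients

[m*n]^o≡m^o*n^o : ∀ m n o → (m * n) ^ o ≡ m ^ o * n ^ o
[m*n]^o≡m^o*n^o m n zero    = refl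
[m*n]^o≡m^o*n^o m n (suc o) = begin
  m * n * (m * n) ^ o      ≡⟨ cong (m * n *_) ([m*n]^o≡m^o*n^o m n o) ⟩
  m * n * (m ^ o * n ^ o)  ≡⟨ interchange m n (m ^ o) (n ^ o) ⟩
  m * m ^ o * (n * n ^ o)  ∎
  where
  open ≡-Reasoning
  interchange : ∀ a b x y → a * b * (x * y) ≡ a * x * (b * y)
  interchange = solve-∀

bernoulli-lower : ∀ q m → q ^ suc m + suc m * q ^ m ≤ suc q ^ suc m
bernoulli-lower q zero    = ≤-reflexive (expand q)
  where
  expand : ∀ q → q * 1 + 1 * 1 ≡ (1 + q) * 1
  expand = solve-∀
bernoulli-lower q (suc m) = begin
  q * q ^ suc m + (2 + m) * q ^ suc m                  ≤⟨ m≤m+n _ (suc m * q ^ m) ⟩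
  q * q ^ suc m + (2 + m) * q ^ suc m + suc m * q ^ m  ≡⟨ factor q (q ^ m) m ⟩
  suc q * (q ^ suc m + suc m * q ^ m)                  ≤⟨ *-monoʳ-≤ (suc q) (bernoulli-lower q m) ⟩
  suc q * suc q ^ suc m                                ∎
  where
  open ≤-Reasoning
  factor : ∀ q x m → q * (q * x) + (2 + m) * (q * x) + (1 + m) * x ≡ (1 + q) * (q * x + (1 + m) * x)
  factor = solve-∀

bernoulli-upper : ∀ q m → suc q ^ suc m ≤ q ^ suc m + suc m * suc q ^ m
bernoulli-upper q zero    = ≤-reflexive (expand q)
  where
  expand : ∀ q → (1 + q) * 1 ≡ q * 1 + 1 * 1
  expand = solve-∀
bernoulli-upper q (suc m) = begin
  suc q ^ suc m + q * suc q ^ suc m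
    ≤⟨ +-monoʳ-≤ (suc q ^ suc m) (*-monoʳ-≤ q (bernoulli-upper q m)) ⟩
  suc q ^ suc m + q * (q ^ suc m + suc m * suc q ^ m)
    ≤⟨ m≤m+n _ (suc m * suc q ^ m) ⟩
  suc q ^ suc m + q * (q ^ suc m + suc m * suc q ^ m) + suc m * suc q ^ m
    ≡⟨ collect q (q ^ suc m) (suc q ^ m) m ⟩
  q * q ^ suc m + (2 + m) * suc q ^ suc m ∎
  where
  open ≤-Reasoning
  collect : ∀ q x y m →
    (1 + q) * y + q * (x + (1 + m) * y) + (1 + m) * y ≡ q * x + (2 + m) * ((1 + q) * y)
  collect = solve-∀

2*m^m≤[1+m]^m : ∀ m .{{_ : NonZero m}} → 2 * m ^ m ≤ suc m ^ m
2*m^m≤[1+m]^m m@(suc i) = begin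
  2 * m ^ m          ≡⟨ cong (m ^ m +_) (+-identityʳ (m ^ m)) ⟩
  m ^ m + m * m ^ i  ≤⟨ bernoulli-lower m i ⟩
  suc m ^ m          ∎
  where open ≤-Reasoning

[1+q]^m≤2*q^m : ∀ q m → 2 * m ≤ suc q → suc q ^ m ≤ 2 * q ^ m
[1+q]^m≤2*q^m q zero    _      = s≤s z≤n
[1+q]^m≤2*q^m q (suc m) 2m≤1+q = +-cancelʳ-≤ (suc q ^ suc m) _ _ (begin
  suc q ^ suc m + suc q ^ suc m          ≡⟨ cong (suc q ^ suc m +_) (+-identityʳ (suc q ^ suc m)) ⟨
  2 * suc q ^ suc m                      ≤⟨ *-monoʳ-≤ 2 (bernoulli-upper q m) ⟩
  2 * (q ^ suc m + suc m * suc q ^ m)    ≡⟨ distribute (q ^ suc m) m (suc q ^ m) ⟩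
  2 * q ^ suc m + 2 * suc m * suc q ^ m  ≤⟨ +-monoʳ-≤ (2 * q ^ suc m) (*-monoˡ-≤ (suc q ^ m) 2m≤1+q) ⟩
  2 * q ^ suc m + suc q ^ suc m          ∎)
  where
  open ≤-Reasoning
  distribute : ∀ x m y → 2 * (x + (1 + m) * y) ≡ 2 * x + 2 * (1 + m) * y
  distribute = solve-∀

c*y^m≤x^m⇒c^t*y^d≤x^d : ∀ {c x y} m t {d} → y ≤ x → c * y ^ m ≤ x ^ m → m * t ≤ d →
                        c ^ t * y ^ d ≤ x ^ d
c*y^m≤x^m⇒c^t*y^d≤x^d {c} {x} {y} m t y≤x c*y^m≤x^m mt≤d with m≤n⇒∃[o]m+o≡n mt≤d
... | r , refl = begin
  c ^ t * y ^ (m * t + r)        ≡⟨ cong (c ^ t *_) (^-distribˡ-+-* y (m * t) r) ⟩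
  c ^ t * (y ^ (m * t) * y ^ r)  ≡⟨ *-assoc (c ^ t) _ _ ⟨
  c ^ t * y ^ (m * t) * y ^ r    ≡⟨ cong (λ z → c ^ t * z * y ^ r) (^-*-assoc y m t) ⟨
  c ^ t * (y ^ m) ^ t * y ^ r    ≡⟨ cong (_* y ^ r) ([m*n]^o≡m^o*n^o c (y ^ m) t) ⟨
  (c * y ^ m) ^ t * y ^ r        ≤⟨ *-mono-≤ (^-monoˡ-≤ t c*y^m≤x^m) (^-monoˡ-≤ r y≤x) ⟩
  (x ^ m) ^ t * x ^ r            ≡⟨ cong (_* x ^ r) (^-*-assoc x m t) ⟩
  x ^ (m * t) * x ^ r            ≡⟨ ^-distribˡ-+-* x (m * t) r ⟨
  x ^ (m * t + r)                ∎
  where open ≤-Reasoning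

x^m≤c*y^m⇒x^e≤c^s*y^e : ∀ {c x y} .{{_ : NonZero y}} m s {e} → y ≤ x → x ^ m ≤ c * y ^ m →
                        e ≤ m * s → x ^ e ≤ c ^ s * y ^ e
x^m≤c*y^m⇒x^e≤c^s*y^e {c} {x} {y} m s {e} y≤x x^m≤c*y^m e≤ms with m≤n⇒∃[o]m+o≡n e≤ms
... | r , e+r≡ms = *-cancelʳ-≤ (x ^ e) (c ^ s * y ^ e) (y ^ r) {{m^n≢0 y r}} (begin
  x ^ e * y ^ r            ≤⟨ *-monoʳ-≤ (x ^ e) (^-monoˡ-≤ r y≤x) ⟩
  x ^ e * x ^ r            ≡⟨ ^-distribˡ-+-* x e r ⟨
  x ^ (e + r)              ≡⟨ cong (x ^_) e+r≡ms ⟩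
  x ^ (m * s)              ≡⟨ ^-*-assoc x m s ⟨
  (x ^ m) ^ s              ≤⟨ ^-monoˡ-≤ s x^m≤c*y^m ⟩
  (c * y ^ m) ^ s          ≡⟨ [m*n]^o≡m^o*n^o c (y ^ m) s ⟩
  c ^ s * (y ^ m) ^ s      ≡⟨ cong (c ^ s *_) (^-*-assoc y m s) ⟩
  c ^ s * y ^ (m * s)      ≡⟨ cong (λ z → c ^ s * y ^ z) e+r≡ms ⟨
  c ^ s * y ^ (e + r)      ≡⟨ cong (c ^ s *_) (^-distribˡ-+-* y e r) ⟩
  c ^ s * (y ^ e * y ^ r)  ≡⟨ *-assoc (c ^ s) _ _ ⟨
  c ^ s * y ^ e * y ^ r    ∎)
  where open ≤-Reasoning

2^t*j^d≤[1+j]^d : ∀ j {t d} → 0 < d → j * t ≤ d → 2 ^ t * j ^ d ≤ suc j ^ d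
2^t*j^d≤[1+j]^d zero      {t} {suc d} _ _    = ≤-trans (≤-reflexive (*-zeroʳ (2 ^ t))) z≤n
2^t*j^d≤[1+j]^d j@(suc _) {t}         _ jt≤d =
  c*y^m≤x^m⇒c^t*y^d≤x^d j t (n≤1+n j) (2*m^m≤[1+m]^m j) jt≤d

n<2^n : ∀ n → n < 2 ^ n
n<2^n zero    = z<s
n<2^n (suc n) = +-mono-≤ (m^n>0 2 n) (≤-trans (n<2^n n) (m≤m+n (2 ^ n) 0))

n<2^[1+⌊log₂n⌋] : ∀ n → n < 2 ^ suc ⌊log₂ n ⌋
n<2^[1+⌊log₂n⌋] n = ≰⇒> λ 2^[1+ℓ]≤n → <-irrefl refl (begin-strict
  ⌊log₂ n ⌋                      <⟨ n<1+n ⌊log₂ n ⌋ ⟩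
  suc ⌊log₂ n ⌋                  ≡⟨ ⌊log₂[2^n]⌋≡n (suc ⌊log₂ n ⌋) ⟨
  ⌊log₂ (2 ^ suc ⌊log₂ n ⌋) ⌋    ≤⟨ ⌊log₂⌋-mono-≤ 2^[1+ℓ]≤n ⟩
  ⌊log₂ n ⌋                      ∎)
  where open ≤-Reasoning

2≤n⇒1≤⌊log₂n⌋ : ∀ {n} → 2 ≤ n → 1 ≤ ⌊log₂ n ⌋
2≤n⇒1≤⌊log₂n⌋ = ⌊log₂⌋-mono-≤

2^⌊log₂n⌋≤n : ∀ n .{{_ : NonZero n}} → 2 ^ ⌊log₂ n ⌋ ≤ n
2^⌊log₂n⌋≤n n = <-rec (λ n → 0 < n → 2 ^ ⌊log₂ n ⌋ ≤ n) halve n (>-nonZero⁻¹ n)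
  where
  open ≤-Reasoning
  halve : ∀ n → (∀ {m} → m < n → 0 < m → 2 ^ ⌊log₂ m ⌋ ≤ m) → 0 < n → 2 ^ ⌊log₂ n ⌋ ≤ n
  halve (suc zero)        _   _ = ≤-refl
  halve n@(suc (suc n-2)) rec _ = begin
    2 ^ ⌊log₂ n ⌋               ≡⟨ cong (2 ^_) (m+[n∸m]≡n (2≤n⇒1≤⌊log₂n⌋ {n} (s≤s (s≤s z≤n)))) ⟨
    2 * 2 ^ (⌊log₂ n ⌋ ∸ 1)     ≡⟨ cong (λ ℓ → 2 * 2 ^ ℓ) (⌊log₂⌊n/2⌋⌋≡⌊log₂n⌋∸1 n) ⟨
    2 * 2 ^ ⌊log₂ ⌊ n /2⌋ ⌋     ≤⟨ *-monoʳ-≤ 2 (rec (⌊n/2⌋<n (suc n-2)) z<s) ⟩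
    2 * ⌊ n /2⌋                 ≡⟨ cong (⌊ n /2⌋ +_) (+-identityʳ ⌊ n /2⌋) ⟩
    ⌊ n /2⌋ + ⌊ n /2⌋           ≤⟨ +-monoʳ-≤ ⌊ n /2⌋ (⌊n/2⌋≤⌈n/2⌉ n) ⟩
    ⌊ n /2⌋ + ⌈ n /2⌉           ≡⟨ ⌊n/2⌋+⌈n/2⌉≡n n ⟩
    n                           ∎

m<[1+m/n]*n : ∀ m n .{{_ : NonZero n}} → m < suc (m / n) * n
m<[1+m/n]*n m n = begin-strict
  m                  ≡⟨ m≡m%n+[m/n]*n m n ⟩
  m % n + m / n * n  <⟨ +-monoˡ-< (m / n * n) (m%n<n m n) ⟩
  n + m / n * n      ∎
  where open ≤-Reasoning

m/o≡n/o⇒n<o+m : ∀ m n o .{{_ : NonZero o}} → m / o ≡ n / o → n < o + m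
m/o≡n/o⇒n<o+m m n o m/o≡n/o = begin-strict
  n                <⟨ m<[1+m/n]*n n o ⟩
  suc (n / o) * o  ≡⟨ cong (λ q → suc q * o) m/o≡n/o ⟨
  o + m / o * o    ≤⟨ +-monoʳ-≤ o (m/n*n≤m m o) ⟩
  o + m            ∎
  where open ≤-Reasoning

4*k*d*2^a*d≤2^t : ∀ a {d k} → 2 ≤ d → k ≤ d → 4 * (k * (d * (2 ^ a * d))) ≤ 2 ^ ((8 + a) * ⌊log₂ d ⌋)
4*k*d*2^a*d≤2^t a {d} {k} 2≤d k≤d = begin
  4 * (k * (d * (2 ^ a * d)))                  ≡⟨ regroup 4 k d (2 ^ a) ⟩
  2 ^ 2 * 2 ^ a * (d * d * k)                  ≤⟨ *-monoʳ-≤ (2 ^ 2 * 2 ^ a)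
                                                    (*-mono-≤ (*-mono-≤ d≤2^s d≤2^s) (≤-trans k≤d d≤2^s)) ⟩
  2 ^ 2 * 2 ^ a * (2 ^ s * 2 ^ s * 2 ^ s)      ≡⟨ cong₂ (λ x y → x * (y * 2 ^ s))
                                                    (^-distribˡ-+-* 2 2 a) (^-distribˡ-+-* 2 s s) ⟨
  2 ^ (2 + a) * (2 ^ (s + s) * 2 ^ s)          ≡⟨ cong (2 ^ (2 + a) *_) (^-distribˡ-+-* 2 (s + s) s) ⟨
  2 ^ (2 + a) * 2 ^ (s + s + s)                ≡⟨ ^-distribˡ-+-* 2 (2 + a) (s + s + s) ⟨
  2 ^ (2 + a + (s + s + s))                    ≤⟨ ^-monoʳ-≤ 2 (exponent≤ ⌊log₂ d ⌋ (2≤n⇒1≤⌊log₂n⌋ 2≤d)) ⟩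
  2 ^ ((8 + a) * ⌊log₂ d ⌋)                    ∎
  where
  open ≤-Reasoning
  s : ℕ
  s = suc ⌊log₂ d ⌋
  d≤2^s : d ≤ 2 ^ s
  d≤2^s = <⇒≤ (n<2^[1+⌊log₂n⌋] d)
  regroup : ∀ c k d x → c * (k * (d * (x * d))) ≡ c * x * (d * d * k)
  regroup = solve-∀
  exponent≤ : ∀ ℓ → 1 ≤ ℓ → 2 + a + (suc ℓ + suc ℓ + suc ℓ) ≤ (8 + a) * ℓ
  exponent≤ (suc i) _ = ≤-trans (m≤m+n _ (5 * i + a * i)) (≤-reflexive (expand a i))
    where
    expand : ∀ a i → 2 + a + (2 + i + (2 + i) + (2 + i)) + (5 * i + a * i) ≡ (8 + a) * (1 + i)
    expand = solve-∀

-- For j = d / t with t = (8 + a) * ⌊log₂ d⌋ the power (j / suc j) ^ d is at most 2 ^ - t,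
-- which absorbs the other factors.
number-of-colours : ∀ a {d} → 2 ≤ d → ∃ λ j →
  d ≤ suc j * ((8 + a) * ⌊log₂ d ⌋) × 4 * (suc j * j ^ d * (d * (2 ^ a * d))) ≤ suc j ^ d
number-of-colours a {d} 2≤d = j , <⇒≤ (m<[1+m/n]*n d t) , (begin
  4 * (suc j * j ^ d * (d * (2 ^ a * d)))    ≡⟨ regroup 4 (suc j) (j ^ d) (d * (2 ^ a * d)) ⟩
  4 * (suc j * (d * (2 ^ a * d))) * j ^ d    ≤⟨ *-monoˡ-≤ (j ^ d) (4*k*d*2^a*d≤2^t a 2≤d (m/n<m d t 1<t)) ⟩
  2 ^ t * j ^ d                              ≤⟨ 2^t*j^d≤[1+j]^d j (<⇒≤ 2≤d) (m/n*n≤m d t) ⟩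
  suc j ^ d                                  ∎)
  where
  open ≤-Reasoning
  t : ℕ
  t = (8 + a) * ⌊log₂ d ⌋
  1<t : 1 < t
  1<t = ≤-trans (s≤s (s≤s z≤n)) (*-mono-≤ (m≤m+n 8 a) (2≤n⇒1≤⌊log₂n⌋ 2≤d))
  instance
    d≢0 : NonZero d
    d≢0 = >-nonZero (<⇒≤ 2≤d)
    t≢0 : NonZero t
    t≢0 = >-nonZero (<⇒≤ 1<t)
  j : ℕ
  j = d / t
  regroup : ∀ c k x y → c * (k * x * y) ≡ c * (k * y) * x
  regroup = solve-∀

-- Sums and counting

sum-mono-≤ : ∀ {n} {f g : Fin n → ℕ} → (∀ i → f i ≤ g i) → sum f ≤ sum g
sum-mono-≤ {zero}  f≤g = z≤n
sum-mono-≤ {suc n} f≤g = +-mono-≤ (f≤g zero) (sum-mono-≤ (f≤g ∘ suc))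

sum-const : ∀ n x → sum {n} (λ _ → x) ≡ n * x
sum-const zero    x = refl
sum-const (suc n) x = cong (x +_) (sum-const n x)

sum-↑ : ∀ m {n} (f : Fin (m + n) → ℕ) → sum f ≡ sum (λ i → f (i ↑ˡ n)) + sum (λ j → f (m ↑ʳ j))
sum-↑ zero    f = refl
sum-↑ (suc m) f = trans (cong (f zero +_) (sum-↑ m (f ∘ suc))) (sym (+-assoc (f zero) _ _))

sum-combine : ∀ m {n} (f : Fin (m * n) → ℕ) → sum f ≡ sum {m} (λ i → sum {n} (λ j → f (combine i j)))
sum-combine zero        f = refl
sum-combine (suc m) {n} f = begin
  sum f
    ≡⟨ sum-↑ n f ⟩
  sum (λ j → f (j ↑ˡ (m * n))) + sum (λ i → f (n ↑ʳ i))
    ≡⟨ cong (sum (λ j → f (j ↑ˡ (m * n))) +_) (sum-combine m (λ i → f (n ↑ʳ i))) ⟩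
  sum (λ j → f (j ↑ˡ (m * n))) + sum {m} (λ i → sum {n} (λ j → f (n ↑ʳ combine i j))) ∎
  where open ≡-Reasoning

sum-tabulate : ∀ {n} (f : Fin n → ℕ) → sumᴸ (List.tabulate f) ≡ sum f
sum-tabulate {zero}  f = refl
sum-tabulate {suc n} f = cong (f zero +_) (sum-tabulate (f ∘ suc))

sum-allFin : ∀ {n} (f : Fin n → ℕ) → sumᴸ (List.map f (allFin n)) ≡ sum f
sum-allFin f = trans (cong sumᴸ (map-tabulate id f)) (sum-tabulate f)

private variable
  X Y : Set
  j k n : ℕ
  P Q : Pred (Fin n) 0ℓ

indicator : Dec X → ℕ
indicator a? = if does a? then 1 else 0

indicator-true : (a? : Dec X) → X → indicator a? ≡ 1
indicator-true (yes _) _ = refl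
indicator-true (no ¬a) a = contradiction a ¬a

indicator-false : (a? : Dec X) → ¬ X → indicator a? ≡ 0
indicator-false (yes a) ¬a = contradiction a ¬a
indicator-false (no _)  _  = refl

indicator-mono : (a? : Dec X) (b? : Dec Y) → (X → Y) → indicator a? ≤ indicator b?
indicator-mono (no _)  _       _   = z≤n
indicator-mono (yes _) (yes _) _   = ≤-refl
indicator-mono (yes a) (no ¬b) a→b = contradiction (a→b a) ¬b

indicator-⊎ : (a? : Dec X) (b? : Dec Y) → indicator (a? ⊎-dec b?) ≤ indicator a? + indicator b?
indicator-⊎ (no _)  b? = ≤-refl
indicator-⊎ (yes _) b? = s≤s z≤n

indicator-any : (P? : Decidable P) → indicator (any? P?) ≤ sum (indicator ∘ P?)
indicator-any {zero}  P? = z≤n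
indicator-any {suc n} P? =
  ≤-trans (indicator-⊎ (P? zero) (any? (P? ∘ suc)))
          (+-monoʳ-≤ (indicator (P? zero)) (indicator-any (P? ∘ suc)))

# : {P : Pred (Fin n) 0ℓ} → Decidable P → ℕ
# P? = sum (indicator ∘ P?)

#-mono : (P? : Decidable P) (Q? : Decidable Q) → P ⊆ Q → # P? ≤ # Q?
#-mono P? Q? P⊆Q = sum-mono-≤ (λ x → indicator-mono (P? x) (Q? x) P⊆Q)

#-cong : (P? : Decidable P) (Q? : Decidable Q) → P ≐ Q → # P? ≡ # Q?
#-cong P? Q? (P⊆Q , Q⊆P) = ≤-antisym (#-mono P? Q? P⊆Q) (#-mono Q? P? Q⊆P)

#-∪ : (P? : Decidable P) (Q? : Decidable Q) → # (P? ∪? Q?) ≤ # P? + # Q?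
#-∪ P? Q? = ≤-trans (sum-mono-≤ (λ x → indicator-⊎ (P? x) (Q? x)))
                    (≤-reflexive (∑-distrib-+ (indicator ∘ P?) (indicator ∘ Q?)))

#-split : (P? : Decidable P) (Q? : Decidable Q) → # P? ≤ # (Q? ∩? P?) + # (∁? Q? ∩? P?)
#-split {P = P} {Q = Q} P? Q? =
  ≤-trans (#-mono P? ((Q? ∩? P?) ∪? (∁? Q? ∩? P?)) decide) (#-∪ (Q? ∩? P?) (∁? Q? ∩? P?))
  where
  decide : ∀ {x} → P x → (Q x × P x) ⊎ (¬ Q x × P x)
  decide {x} Px with Q? x
  ... | yes Qx = inj₁ (Qx , Px)
  ... | no ¬Qx = inj₂ (¬Qx , Px)

#-⋃ : {R : Fin k → Pred (Fin n) 0ℓ} (R? : ∀ i → Decidable (R i)) →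
      # (λ x → any? (λ i → R? i x)) ≤ sum (λ i → # (R? i))
#-⋃ R? = ≤-trans (sum-mono-≤ (λ x → indicator-any (λ i → R? i x)))
                 (≤-reflexive (∑-comm (λ x i → indicator (R? i x))))

#-×-dec : {P : Pred (Fin n) 0ℓ} (a? : Dec X) (P? : Decidable P) →
          # (λ x → a? ×-dec P? x) ≡ indicator a? * # P?
#-×-dec         (yes _) P? = sym (*-identityˡ (# P?))
#-×-dec {n = n} (no _)  P? = sum-replicate-zero n

#>0⇒∃ : (P? : Decidable P) → 0 < # P? → ∃ P
#>0⇒∃ {suc n} P? #P>0 with P? zero
... | yes p0 = zero , p0
... | no  _  = let x , px = #>0⇒∃ (P? ∘ suc) #P>0 in suc x , px

#-≡ : (v : Fin n) → # (_≟ᶠ v) ≡ 1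
#-≡ {suc n} zero    = cong suc (sum-replicate-zero n)
#-≡         (suc v) = #-≡ v

#-≢ : (v : Fin (suc n)) → # (λ w → ¬? (w ≟ᶠ v)) ≡ n
#-≢ {n}     zero    = trans (sum-const n 1) (*-identityʳ n)
#-≢ {suc n} (suc v) = cong suc (#-≢ v)

another-element : (P? : Decidable P) → 2 ≤ # P? → ∀ v → ∃ λ w → w ≢ v × P w
another-element P? 2≤|P| v = #>0⇒∃ (∁? (_≟ᶠ v) ∩? P?) (≤-pred (begin
  2                                                ≤⟨ 2≤|P| ⟩
  # P?                                             ≤⟨ #-split P? (_≟ᶠ v) ⟩
  # ((_≟ᶠ v) ∩? P?) + # (∁? (_≟ᶠ v) ∩? P?)         ≤⟨ +-monoˡ-≤ _ (#-mono ((_≟ᶠ v) ∩? P?) (_≟ᶠ v) proj₁) ⟩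
  # (_≟ᶠ v) + # (∁? (_≟ᶠ v) ∩? P?)                 ≡⟨ cong (_+ # (∁? (_≟ᶠ v) ∩? P?)) (#-≡ v) ⟩
  1 + # (∁? (_≟ᶠ v) ∩? P?)                         ∎))
  where open ≤-Reasoning

subset-of-size : {P : Pred (Fin n) 0ℓ} (P? : Decidable P) → ∀ d → d ≤ # P? →
                 ∃ λ V → # (_∈? V) ≡ d × (∀ {w} → w ∈ V → P w)
subset-of-size {zero}  P? zero    _     = []ᵛ , refl , λ ()
subset-of-size {suc n} P? zero    _     =
  let V , |V|≡d , V⊆P = subset-of-size (P? ∘ suc) 0 z≤n in outside ∷ V , |V|≡d , λ { (there w∈V) → V⊆P w∈V }
subset-of-size {suc n} P? (suc d) d≤|P| with P? zero
... | yes P0 = let V , |V|≡d , V⊆P = subset-of-size (P? ∘ suc) d (≤-pred d≤|P|)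
               in inside ∷ V , cong suc |V|≡d , λ { here → P0 ; (there w∈V) → V⊆P w∈V }
... | no  _  = let V , |V|≡d , V⊆P = subset-of-size (P? ∘ suc) (suc d) d≤|P|
               in outside ∷ V , |V|≡d , λ { (there w∈V) → V⊆P w∈V }

length-filter-tabulate : {P : Pred X 0ℓ} (P? : Decidable P) (f : Fin n → X) →
                         length (filter P? (List.tabulate f)) ≡ # (P? ∘ f)
length-filter-tabulate {n = zero}  P? f = refl
length-filter-tabulate {n = suc _} P? f with does (P? (f zero))
... | true  = cong suc (length-filter-tabulate P? (f ∘ suc))
... | false = length-filter-tabulate P? (f ∘ suc)

-- The local lemma

Avoids : {I Ω : Set} → (I → Pred Ω 0ℓ) → List I → Pred Ω 0ℓ
Avoids Bad S ω = All (λ v → ¬ Bad v ω) S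

avoids? : {I Ω : Set} {Bad : I → Pred Ω 0ℓ} → (∀ v → Decidable (Bad v)) →
          ∀ S → Decidable (Avoids Bad S)
avoids? bad? S ω = All.all? (λ v → ¬? (bad? v ω)) S

-- The symmetric, lopsided form in the uniform probability space Fin N: instead of independence it is
-- assumed that a / b bounds the probability of Bad v conditioned on avoiding any events not adjacent to v.
module LocalLemma
  {I : Set} {N : ℕ} .{{_ : NonZero N}} {Bad : I → Pred (Fin N) 0ℓ} (bad? : ∀ v → Decidable (Bad v))
  {_~_ : Rel I 0ℓ} (_~?_ : Decidable₂ _~_)
  (a b Δ : ℕ) .{{_ : NonZero b}} .{{_ : NonZero Δ}} (4aΔ≤b : 4 * (a * Δ) ≤ b)
  (rare : ∀ v S → All (λ u → ¬ v ~ u) S → b * # (bad? v ∩? avoids? bad? S) ≤ a * # (avoids? bad? S))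
  where

  Sparse : List I → Set
  Sparse S = ∀ v → length (filter (v ~?_) S) ≤ Δ

  Sparse-⊆ : ∀ {S S′} → S ⊆ᴸ S′ → Sparse S′ → Sparse S
  Sparse-⊆ S⊆S′ sparse v = ≤-trans (length-mono-≤ (⊆-filter⁺ (v ~?_) (v ~?_) (λ { refl → id }) S⊆S′))
                                   (sparse v)

  #avoids : List I → ℕ
  #avoids S = # (avoids? bad? S)

  bad-avoids? : ∀ v S → Decidable (Bad v ∩ Avoids Bad S)
  bad-avoids? v S = bad? v ∩? avoids? bad? S

  #bad-avoids : I → List I → ℕ
  #bad-avoids v S = # (bad-avoids? v S)

  #avoids≤#bad-avoids+#avoids-∷ : ∀ v S → #avoids S ≤ #bad-avoids v S + #avoids (v ∷ S)
  #avoids≤#bad-avoids+#avoids-∷ v S = ≤-trans (#-split (avoids? bad? S) (bad? v)) (+-monoʳ-≤ (#bad-avoids v S)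
    (#-mono (∁? (bad? v) ∩? avoids? bad? S) (avoids? bad? (v ∷ S)) λ (¬bad , avoidsS) → ¬bad ∷ avoidsS))

  #avoids≤#avoids+∑#bad-avoids : ∀ {A B S} → Avoids Bad A ∩ Avoids Bad B ⊆ Avoids Bad S →
    #avoids B ≤ #avoids S + sum (λ i → #bad-avoids (lookup A i) B)
  #avoids≤#avoids+∑#bad-avoids {A} {B} {S} avoidsAB⇒avoidsS = begin
    #avoids B
      ≤⟨ #-mono (avoids? bad? B) (avoids? bad? S ∪? someBad?) split ⟩
    # (avoids? bad? S ∪? someBad?)
      ≤⟨ #-∪ (avoids? bad? S) someBad? ⟩
    #avoids S + # someBad?
      ≤⟨ +-monoʳ-≤ (#avoids S) (#-⋃ (λ i → bad-avoids? (lookup A i) B)) ⟩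
    #avoids S + sum (λ i → #bad-avoids (lookup A i) B) ∎
    where
    open ≤-Reasoning
    someBad? : Decidable (λ ω → ∃ λ i → Bad (lookup A i) ω × Avoids Bad B ω)
    someBad? ω = any? (λ i → bad-avoids? (lookup A i) B ω)
    split : ∀ {ω} → Avoids Bad B ω → Avoids Bad S ω ⊎ (∃ λ i → Bad (lookup A i) ω × Avoids Bad B ω)
    split {ω} avoidsB with Any.any? (λ v → bad? v ω) A
    ... | yes bad  = inj₂ (Any.index bad , lookup-index bad , avoidsB)
    ... | no  ¬bad = inj₁ (avoidsAB⇒avoidsS (¬Any⇒All¬ A ¬bad , avoidsB))

  -- The events in A remove at most a fraction Δ * (2 * a / b) ≤ 1 / 2 of the outcomes avoiding B.
  #avoids≤2*#avoids : ∀ {A B S} → length A ≤ Δ → Avoids Bad A ∩ Avoids Bad B ⊆ Avoids Bad S →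
    (∀ u → u ∈ᴸ A → b * #bad-avoids u B ≤ 2 * a * #avoids B) → #avoids B ≤ 2 * #avoids S
  #avoids≤2*#avoids {A} {B} {S} |A|≤Δ avoidsAB⇒avoidsS bound = *-cancelˡ-≤ b (+-cancelʳ-≤ (b * G) _ _ (begin
    b * G + b * G                                ≡⟨ double (b * G) ⟩
    2 * (b * G)                                  ≤⟨ *-monoʳ-≤ 2 (*-monoʳ-≤ b
                                                      (#avoids≤#avoids+∑#bad-avoids avoidsAB⇒avoidsS)) ⟩
    2 * (b * (#avoids S + sum F))                ≡⟨ distribute b (#avoids S) (sum F) ⟩
    b * (2 * #avoids S) + 2 * (b * sum F)        ≤⟨ +-monoʳ-≤ (b * (2 * #avoids S)) (*-monoʳ-≤ 2 b*∑F≤) ⟩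
    b * (2 * #avoids S) + 2 * (Δ * (2 * a * G))  ≡⟨ cong (b * (2 * #avoids S) +_) (regroup Δ a G) ⟩
    b * (2 * #avoids S) + 4 * (a * Δ) * G        ≤⟨ +-monoʳ-≤ (b * (2 * #avoids S)) (*-monoˡ-≤ G 4aΔ≤b) ⟩
    b * (2 * #avoids S) + b * G                  ∎))
    where
    open ≤-Reasoning
    G : ℕ
    G = #avoids B
    F : Fin (length A) → ℕ
    F i = #bad-avoids (lookup A i) B
    b*∑F≤ : b * sum F ≤ Δ * (2 * a * G)
    b*∑F≤ = begin
      b * sum F                         ≡⟨ *-distribˡ-sum b F ⟩
      sum (λ i → b * F i)               ≤⟨ sum-mono-≤ {f = λ i → b * F i}
                                             (λ i → bound (lookup A i) (∈-lookup i)) ⟩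
      sum {length A} (λ _ → 2 * a * G)  ≡⟨ sum-const (length A) (2 * a * G) ⟩
      length A * (2 * a * G)            ≤⟨ *-monoˡ-≤ (2 * a * G) |A|≤Δ ⟩
      Δ * (2 * a * G)                   ∎
    double : ∀ x → x + x ≡ 2 * x
    double = solve-∀
    distribute : ∀ b x y → 2 * (b * (x + y)) ≡ b * (2 * x) + 2 * (b * y)
    distribute = solve-∀
    regroup : ∀ Δ a g → 2 * (Δ * (2 * a * g)) ≡ 4 * (a * Δ) * g
    regroup = solve-∀

  b*#bad-avoids≤2a*#avoids : ∀ S → Acc _<_ (length S) → Sparse S →
    ∀ v → b * #bad-avoids v S ≤ 2 * a * #avoids S
  b*#bad-avoids≤2a*#avoids S (acc rec) sparse v = begin
    b * #bad-avoids v S  ≤⟨ *-monoʳ-≤ b (#-mono (bad-avoids? v S) (bad-avoids? v B)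
                              (map₂ (filter⁺ (∁? (v ~?_))))) ⟩
    b * #bad-avoids v B  ≤⟨ rare v B (all-filter (∁? (v ~?_)) S) ⟩
    a * #avoids B        ≤⟨ *-monoʳ-≤ a (#avoids≤2*#avoids {A} {B} {S} (sparse v)
                              (uncurry (filter⁻ (v ~?_))) bound) ⟩
    a * (2 * #avoids S)  ≡⟨ regroup a (#avoids S) ⟩
    2 * a * #avoids S    ∎
    where
    open ≤-Reasoning
    A B : List I
    A = filter (v ~?_) S
    B = filter (∁? (v ~?_)) S
    |B|<|S| : ∀ {u} → u ∈ᴸ A → length B < length S
    |B|<|S| u∈A = let u∈S , v~u = ∈-filter⁻ (v ~?_) {xs = S} u∈A
                  in filter-notAll (∁? (v ~?_)) S (lose u∈S (λ ¬v~u → ¬v~u v~u))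
    bound : ∀ u → u ∈ᴸ A → b * #bad-avoids u B ≤ 2 * a * #avoids B
    bound u u∈A = b*#bad-avoids≤2a*#avoids B (rec (|B|<|S| u∈A)) (Sparse-⊆ (filter-⊆ (∁? (v ~?_)) S) sparse) u
    regroup : ∀ a g → a * (2 * g) ≡ 2 * a * g
    regroup = solve-∀

  2a<b : 2 * a < b
  2a<b = *-cancelˡ-< 2 _ _ (begin-strict
    2 * (2 * a)      ≡⟨ *-assoc 2 2 a ⟨
    4 * a            ≤⟨ *-monoʳ-≤ 4 (m≤m*n a Δ) ⟩
    4 * (a * Δ)      ≤⟨ 4aΔ≤b ⟩
    b                <⟨ m<m*n b 2 ≤-refl ⟩
    b * 2            ≡⟨ *-comm b 2 ⟩
    2 * b            ∎)
    where open ≤-Reasoning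

  #avoids>0 : ∀ S → Sparse S → 0 < #avoids S
  #avoids>0 []      _      = begin-strict
    0                  <⟨ >-nonZero⁻¹ N ⟩
    N                  ≡⟨ *-identityʳ N ⟨
    N * 1              ≡⟨ sum-const N 1 ⟨
    sum {N} (λ _ → 1)  ∎
    where open ≤-Reasoning
  #avoids>0 (v ∷ S) sparse = +-cancelˡ-< (#bad-avoids v S) _ _ (begin-strict
    #bad-avoids v S + 0                  ≡⟨ +-identityʳ _ ⟩
    #bad-avoids v S                      <⟨ *-cancelˡ-< b _ _ b*#bad-avoids<b*#avoids ⟩
    #avoids S                            ≤⟨ #avoids≤#bad-avoids+#avoids-∷ v S ⟩
    #bad-avoids v S + #avoids (v ∷ S)    ∎)
    where
    open ≤-Reasoning
    sparseS : Sparse S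
    sparseS = Sparse-⊆ (v ∷ʳ ⊆-refl) sparse
    b*#bad-avoids<b*#avoids : b * #bad-avoids v S < b * #avoids S
    b*#bad-avoids<b*#avoids = begin-strict
      b * #bad-avoids v S    ≤⟨ b*#bad-avoids≤2a*#avoids S (<-wellFounded (length S)) sparseS v ⟩
      2 * a * #avoids S      <⟨ *-monoˡ-< (#avoids S) {{>-nonZero (#avoids>0 S sparseS)}} 2a<b ⟩
      b * #avoids S          ∎

  all-avoidable : ∀ S → Sparse S → ∃ (Avoids Bad S)
  all-avoidable S sparse = #>0⇒∃ (avoids? bad? S) (#avoids>0 S sparse)

-- Rainbow colourings

Colouring : ℕ → ℕ → Set
Colouring k n = Fin n → Fin k

-- The colourings are enumerated by finToFun. The colouring with number combine c x agrees with
-- c ∷ᶠ finToFun x only pointwise, so that events have to respect _≗_ to be counted colour by colour.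
#ᶜ : {P : Pred (Colouring k n) 0ℓ} → Decidable P → ℕ
#ᶜ P? = # (P? ∘ finToFun)

#ᶜ-cong : {P Q : Pred (Colouring k n) 0ℓ} (P? : Decidable P) (Q? : Decidable Q) → P ≐ Q → #ᶜ P? ≡ #ᶜ Q?
#ᶜ-cong P? Q? (P⊆Q , Q⊆P) = #-cong (P? ∘ finToFun) (Q? ∘ finToFun) (P⊆Q , Q⊆P)

#ᶜ-suc : {P : Pred (Colouring k (suc n)) 0ℓ} (P? : Decidable P) → P Respects _≗_ →
         #ᶜ P? ≡ sum (λ c → #ᶜ (λ φ → P? (c ∷ᶠ φ)))
#ᶜ-suc {k} {n} {P} P? resp = trans (sum-combine k {k ^ n} (indicator ∘ P? ∘ finToFun))
  (sum-cong-≗ (λ c → #-cong (P? ∘ finToFun ∘ combine c) (λ x → P? (c ∷ᶠ finToFun x))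
    (resp (finToFun-combine c _) , resp (sym ∘ finToFun-combine c _))))
  where
  finToFun-combine : ∀ c x → finToFun {k} {suc n} (combine c x) ≗ c ∷ᶠ finToFun x
  finToFun-combine c x zero    = cong proj₁ (remQuot-combine c x)
  finToFun-combine c x (suc w) = cong (λ (_ , y) → finToFun y w) (remQuot-combine c x)

_IndependentOf_ : Pred (Colouring k n) 0ℓ → Pred (Fin n) 0ℓ → Set
P IndependentOf U = ∀ {φ ψ} → (∀ w → ¬ U w → φ w ≡ ψ w) → P φ → P ψ

independent⇒respects : {P : Pred (Colouring k n) 0ℓ} {U : Pred (Fin n) 0ℓ} →
                       P IndependentOf U → P Respects _≗_
independent⇒respects indep φ≗ψ = indep (λ w _ → φ≗ψ w)

independent-∷ : {P : Pred (Colouring k (suc n)) 0ℓ} {U : Pred (Fin (suc n)) 0ℓ} →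
                P IndependentOf U → ∀ c → (P ∘ (c ∷ᶠ_)) IndependentOf (U ∘ suc)
independent-∷ indep c agree = indep λ { zero _ → refl ; (suc w) → agree w }

Hits : Pred (Fin n) 0ℓ → Fin k → Pred (Colouring k n) 0ℓ
Hits U i φ = ∃ λ w → U w × φ w ≡ i

hits? : {U : Pred (Fin n) 0ℓ} → Decidable U → (i : Fin k) → Decidable (Hits U i)
hits? U? i φ = any? (λ w → U? w ×-dec φ w ≟ᶠ i)

Hits-respects : {U : Pred (Fin n) 0ℓ} {i : Fin k} → Hits U i Respects _≗_
Hits-respects φ≗ψ (w , Uw , φw≡i) = w , Uw , trans (sym (φ≗ψ w)) φw≡i

misses? : {U : Pred (Fin n) 0ℓ} → Decidable U → (i : Fin k) → Decidable (∁ (Hits U i))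
misses? U? i = ∁? (hits? U? i)

-- Colour i is missing on U with probability (j / suc j) ^ |U| given H.
MissProbability : {U : Pred (Fin n) 0ℓ} → Decidable U → Fin (suc j) →
                  {H : Pred (Colouring (suc j) n) 0ℓ} → Decidable H → Set
MissProbability {j = j} U? i H? = suc j ^ # U? * #ᶜ (misses? U? i ∩? H?) ≡ j ^ # U? * #ᶜ H?

module _ {U : Pred (Fin (suc n)) 0ℓ} (U? : Decidable U) (i : Fin (suc j))
         {H : Pred (Colouring (suc j) (suc n)) 0ℓ} (H? : Decidable H) (indep : H IndependentOf U) where

  #ᶜ-misses-suc : #ᶜ (misses? U? i ∩? H?) ≡ sum (λ c → #ᶜ (λ φ → (misses? U? i ∩? H?) (c ∷ᶠ φ)))
  #ᶜ-misses-suc = #ᶜ-suc (misses? U? i ∩? H?) λ φ≗ψ (misses , Hφ) →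
    misses ∘ Hits-respects (sym ∘ φ≗ψ) , independent⇒respects indep φ≗ψ Hφ

  #ᶜ-misses-zero∉ : ¬ U zero →
    #ᶜ (misses? U? i ∩? H?) ≡ sum (λ c → #ᶜ (misses? (U? ∘ suc) i ∩? (H? ∘ (c ∷ᶠ_))))
  #ᶜ-misses-zero∉ ¬U0 = trans #ᶜ-misses-suc (sum-cong-≗ (λ c →
    #ᶜ-cong (λ φ → (misses? U? i ∩? H?) (c ∷ᶠ φ)) (misses? (U? ∘ suc) i ∩? (H? ∘ (c ∷ᶠ_)))
      ( map₁ (λ misses (w , Uw , φw≡i) → misses (suc w , Uw , φw≡i))
      , map₁ λ { misses (zero  , U0 , _) → ¬U0 U0
               ; misses (suc w , Uw , φw≡i) → misses (w , Uw , φw≡i) })))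

  module _ (U0 : U zero) (c₀ : Fin (suc j)) where

    slice-≐ : ∀ c → (H ∘ (c ∷ᶠ_)) ≐ (H ∘ (c₀ ∷ᶠ_))
    slice-≐ c = recolour , recolour
      where
      recolour : ∀ {c c′ φ} → H (c ∷ᶠ φ) → H (c′ ∷ᶠ φ)
      recolour = indep λ { zero ¬U0 → contradiction U0 ¬U0 ; (suc w) _ → refl }

    #ᶜ-zero∈ : #ᶜ H? ≡ suc j * #ᶜ (H? ∘ (c₀ ∷ᶠ_))
    #ᶜ-zero∈ = begin
      #ᶜ H?
        ≡⟨ #ᶜ-suc H? (independent⇒respects indep) ⟩
      sum (λ c → #ᶜ (H? ∘ (c ∷ᶠ_)))
        ≡⟨ sum-cong-≗ (λ c → #ᶜ-cong (H? ∘ (c ∷ᶠ_)) (H? ∘ (c₀ ∷ᶠ_)) (slice-≐ c)) ⟩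
      sum {suc j} (λ _ → #ᶜ (H? ∘ (c₀ ∷ᶠ_)))
        ≡⟨ sum-const (suc j) _ ⟩
      suc j * #ᶜ (H? ∘ (c₀ ∷ᶠ_)) ∎
      where open ≡-Reasoning

    #ᶜ-misses-zero∈ : #ᶜ (misses? U? i ∩? H?) ≡ j * #ᶜ (misses? (U? ∘ suc) i ∩? (H? ∘ (c₀ ∷ᶠ_)))
    #ᶜ-misses-zero∈ = begin
      #ᶜ (misses? U? i ∩? H?)
        ≡⟨ #ᶜ-misses-suc ⟩
      sum (λ c → #ᶜ (λ φ → (misses? U? i ∩? H?) (c ∷ᶠ φ)))
        ≡⟨ sum-cong-≗ (λ c → #ᶜ-cong (λ φ → (misses? U? i ∩? H?) (c ∷ᶠ φ)) (λ φ → ¬? (c ≟ᶠ i) ×-dec rest? φ)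
             (misses⇒ c , misses⇐ c)) ⟩
      sum (λ c → #ᶜ (λ φ → ¬? (c ≟ᶠ i) ×-dec rest? φ))
        ≡⟨ sum-cong-≗ (λ c → #-×-dec (¬? (c ≟ᶠ i)) (rest? ∘ finToFun)) ⟩
      sum (λ c → indicator (¬? (c ≟ᶠ i)) * #ᶜ rest?)
        ≡⟨ *-distribʳ-sum (#ᶜ rest?) (λ c → indicator (¬? (c ≟ᶠ i))) ⟨
      # (λ c → ¬? (c ≟ᶠ i)) * #ᶜ rest?
        ≡⟨ cong (_* #ᶜ rest?) (#-≢ i) ⟩
      j * #ᶜ rest? ∎
      where
      open ≡-Reasoning
      rest? : Decidable (∁ (Hits (U ∘ suc) i) ∩ (H ∘ (c₀ ∷ᶠ_)))
      rest? = misses? (U? ∘ suc) i ∩? (H? ∘ (c₀ ∷ᶠ_))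
      misses⇒ : ∀ c {φ} → ¬ Hits U i (c ∷ᶠ φ) × H (c ∷ᶠ φ) → c ≢ i × ¬ Hits (U ∘ suc) i φ × H (c₀ ∷ᶠ φ)
      misses⇒ c (misses , Hφ) = (λ c≡i → misses (zero , U0 , c≡i))
        , (λ (w , Uw , φw≡i) → misses (suc w , Uw , φw≡i)) , proj₁ (slice-≐ c) Hφ
      misses⇐ : ∀ c {φ} → c ≢ i × ¬ Hits (U ∘ suc) i φ × H (c₀ ∷ᶠ φ) → ¬ Hits U i (c ∷ᶠ φ) × H (c ∷ᶠ φ)
      misses⇐ c (c≢i , misses , Hφ) = (λ { (zero , _ , c≡i) → c≢i c≡i
                                         ; (suc w , Uw , φw≡i) → misses (w , Uw , φw≡i) })
                                    , proj₂ (slice-≐ c) Hφ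

  missProbability-zero∉ : ¬ U zero → (∀ c → MissProbability (U? ∘ suc) i (H? ∘ (c ∷ᶠ_))) →
                          MissProbability U? i H?
  missProbability-zero∉ ¬U0 inductive-hypothesis = begin
    suc j ^ # U? * #ᶜ (misses? U? i ∩? H?)
      ≡⟨ cong₂ (λ s x → suc j ^ s * x) |U|≡|U′| (#ᶜ-misses-zero∉ ¬U0) ⟩
    suc j ^ # U′? * sum (λ c → #ᶜ (misses? U′? i ∩? slice? c))
      ≡⟨ *-distribˡ-sum (suc j ^ # U′?) (λ c → #ᶜ (misses? U′? i ∩? slice? c)) ⟩
    sum (λ c → suc j ^ # U′? * #ᶜ (misses? U′? i ∩? slice? c))
      ≡⟨ sum-cong-≗ inductive-hypothesis ⟩
    sum (λ c → j ^ # U′? * #ᶜ (slice? c))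
      ≡⟨ *-distribˡ-sum (j ^ # U′?) (λ c → #ᶜ (slice? c)) ⟨
    j ^ # U′? * sum (λ c → #ᶜ (slice? c))
      ≡⟨ cong₂ (λ s x → j ^ s * x) |U|≡|U′| (#ᶜ-suc H? (independent⇒respects indep)) ⟨
    j ^ # U? * #ᶜ H? ∎
    where
    open ≡-Reasoning
    U′? : Decidable (U ∘ suc)
    U′? = U? ∘ suc
    slice? : ∀ c → Decidable (H ∘ (c ∷ᶠ_))
    slice? c = H? ∘ (c ∷ᶠ_)
    |U|≡|U′| : # U? ≡ # U′?
    |U|≡|U′| = cong (_+ # U′?) (indicator-false (U? zero) ¬U0)

  missProbability-zero∈ : U zero → MissProbability (U? ∘ suc) i (H? ∘ (i ∷ᶠ_)) → MissProbability U? i H?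
  missProbability-zero∈ U0 inductive-hypothesis = begin
    suc j ^ # U? * #ᶜ (misses? U? i ∩? H?)
      ≡⟨ cong₂ (λ s x → suc j ^ s * x) |U|≡1+|U′| (#ᶜ-misses-zero∈ U0 i) ⟩
    suc j * suc j ^ # U′? * (j * #ᶜ (misses? U′? i ∩? slice?))
      ≡⟨ pull-out (suc j) (suc j ^ # U′?) j (#ᶜ (misses? U′? i ∩? slice?)) ⟩
    suc j * j * (suc j ^ # U′? * #ᶜ (misses? U′? i ∩? slice?))
      ≡⟨ cong (suc j * j *_) inductive-hypothesis ⟩
    suc j * j * (j ^ # U′? * #ᶜ slice?)
      ≡⟨ push-in (suc j) j (j ^ # U′?) (#ᶜ slice?) ⟩
    j * j ^ # U′? * (suc j * #ᶜ slice?)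
      ≡⟨ cong₂ (λ s x → j ^ s * x) |U|≡1+|U′| (#ᶜ-zero∈ U0 i) ⟨
    j ^ # U? * #ᶜ H? ∎
    where
    open ≡-Reasoning
    U′? : Decidable (U ∘ suc)
    U′? = U? ∘ suc
    slice? : Decidable (H ∘ (i ∷ᶠ_))
    slice? = H? ∘ (i ∷ᶠ_)
    |U|≡1+|U′| : # U? ≡ suc (# U′?)
    |U|≡1+|U′| = cong (_+ # U′?) (indicator-true (U? zero) U0)
    pull-out : ∀ a b c d → a * b * (c * d) ≡ a * c * (b * d)
    pull-out = solve-∀
    push-in : ∀ a b c d → a * b * (c * d) ≡ b * c * (a * d)
    push-in = solve-∀

missProbability : {U : Pred (Fin n) 0ℓ} (U? : Decidable U) (i : Fin (suc j))
                  {H : Pred (Colouring (suc j) n) 0ℓ} (H? : Decidable H) →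
                  H IndependentOf U → MissProbability U? i H?
missProbability {zero}  U? i H? indep = refl
missProbability {suc n} U? i H? indep = case U? zero of λ where
  (no ¬U0) → missProbability-zero∉ U? i H? indep ¬U0 λ c →
    missProbability (U? ∘ suc) i (H? ∘ (c ∷ᶠ_)) (independent-∷ indep c)
  (yes U0) → missProbability-zero∈ U? i H? indep U0
    (missProbability (U? ∘ suc) i (H? ∘ (i ∷ᶠ_)) (independent-∷ indep i))

MissesSome : ∀ k → Pred (Fin n) 0ℓ → Pred (Colouring k n) 0ℓ
MissesSome k U φ = ∃ λ (i : Fin k) → ¬ Hits U i φ

missesSome? : {U : Pred (Fin n) 0ℓ} → Decidable U → Decidable (MissesSome k U)
missesSome? U? φ = any? (λ i → misses? U? i φ)

#ᶜ-missesSome : {U : Pred (Fin n) 0ℓ} (U? : Decidable U) {H : Pred (Colouring (suc j) n) 0ℓ}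
                (H? : Decidable H) → H IndependentOf U →
                suc j ^ # U? * #ᶜ (missesSome? U? ∩? H?) ≤ suc j * j ^ # U? * #ᶜ H?
#ᶜ-missesSome {j = j} {U} U? {H} H? indep = begin
  suc j ^ s * #ᶜ (missesSome? U? ∩? H?)
    ≤⟨ *-monoʳ-≤ (suc j ^ s) (#-mono ((missesSome? U? ∩? H?) ∘ finToFun) someMissed?
         λ ((i , misses) , Hφ) → i , misses , Hφ) ⟩
  suc j ^ s * # someMissed?
    ≤⟨ *-monoʳ-≤ (suc j ^ s) (#-⋃ (λ i → (misses? U? i ∩? H?) ∘ finToFun)) ⟩
  suc j ^ s * sum (λ i → #ᶜ (misses? U? i ∩? H?))
    ≡⟨ *-distribˡ-sum (suc j ^ s) (λ i → #ᶜ (misses? U? i ∩? H?)) ⟩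
  sum (λ i → suc j ^ s * #ᶜ (misses? U? i ∩? H?))
    ≡⟨ sum-cong-≗ (λ i → missProbability U? i H? indep) ⟩
  sum {suc j} (λ _ → j ^ s * #ᶜ H?)
    ≡⟨ sum-const (suc j) _ ⟩
  suc j * (j ^ s * #ᶜ H?)
    ≡⟨ *-assoc (suc j) (j ^ s) (#ᶜ H?) ⟨
  suc j * j ^ s * #ᶜ H? ∎
  where
  open ≤-Reasoning
  s : ℕ
  s = # U?
  someMissed? : Decidable (λ x → ∃ λ i → (∁ (Hits U i) ∩ H) (finToFun x))
  someMissed? x = any? (λ i → (misses? U? i ∩? H?) (finToFun x))

_Meets_ : Subset n → Subset n → Set
U Meets V = ∃ λ w → w ∈ U × w ∈ V

_meets?_ : (U V : Subset n) → Dec (U Meets V)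
U meets? V = any? (λ w → (w ∈? U) ×-dec (w ∈? V))

#-meets : ∀ {m d K} (V : Fin m → Subset n) → (∀ v → # (_∈? V v) ≡ d) → (∀ w → # (λ u → w ∈? V u) ≤ K) →
          ∀ v → # (λ u → V v meets? V u) ≤ d * K
#-meets {m = m} {d} {K} V |V|≡d degree≤K v = begin
  # (λ u → V v meets? V u)
    ≤⟨ #-⋃ (λ w u → (w ∈? V v) ×-dec (w ∈? V u)) ⟩
  sum (λ w → # (λ u → (w ∈? V v) ×-dec (w ∈? V u)))
    ≡⟨ sum-cong-≗ (λ w → #-×-dec (w ∈? V v) (λ u → w ∈? V u)) ⟩
  sum (λ w → indicator (w ∈? V v) * # (λ u → w ∈? V u))
    ≤⟨ sum-mono-≤ (λ w → *-monoʳ-≤ (indicator (w ∈? V v)) (degree≤K w)) ⟩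
  sum (λ w → indicator (w ∈? V v) * K)
    ≡⟨ *-distribʳ-sum K (λ w → indicator (w ∈? V v)) ⟨
  # (_∈? V v) * K
    ≡⟨ cong (_* K) (|V|≡d v) ⟩
  d * K ∎
  where open ≤-Reasoning

misses-independent : {U V : Subset n} → ¬ U Meets V → ∁ (MissesSome k (_∈ V)) IndependentOf (_∈ U)
misses-independent ¬meets agree ¬missesφ (i , missesψ) = ¬missesφ (i , λ (w , w∈V , φw≡i) →
  missesψ (w , w∈V , trans (sym (agree w (λ w∈U → ¬meets (w , w∈U , w∈V)))) φw≡i))

avoids-independent : ∀ {m} {U : Subset n} (V : Fin m → Subset n) {S} → All (λ u → ¬ U Meets V u) S →
                     Avoids (λ u → MissesSome k (_∈ V u)) S IndependentOf (_∈ U)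
avoids-independent {U = U} V disjoint agree avoids =
  All.zipWith (λ {u} (¬meets , ¬misses) → misses-independent {U = U} {V u} ¬meets agree ¬misses)
              (disjoint , avoids)

rainbow-colouring : ∀ {m j d Δ} .{{_ : NonZero Δ}} (V : Fin m → Subset n) →
  (∀ v → # (_∈? V v) ≡ d) → (∀ v → # (λ u → V v meets? V u) ≤ Δ) →
  4 * (suc j * j ^ d * Δ) ≤ suc j ^ d → ∃ λ (φ : Colouring (suc j) n) → ∀ v i → Hits (_∈ V v) i φ
rainbow-colouring {n} {m} {j} {d} {Δ} V |V|≡d meets≤Δ 4*[k*j^d*Δ]≤k^d = φ , λ v i →
    decidable-stable (hits? (_∈? V v) i φ) (λ misses → All.lookup φ-avoids (∈-allFin v) (i , misses))
  where
  missing? : ∀ v → Decidable (MissesSome (suc j) (_∈ V v))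
  missing? v = missesSome? (_∈? V v)
  rare : ∀ v S → All (λ u → ¬ V v Meets V u) S →
         suc j ^ d * #ᶜ (missing? v ∩? avoids? missing? S) ≤ suc j * j ^ d * #ᶜ (avoids? missing? S)
  rare v S disjoint =
    subst (λ s → suc j ^ s * #ᶜ (missing? v ∩? avoids? missing? S) ≤ suc j * j ^ s * #ᶜ (avoids? missing? S))
      (|V|≡d v)
      (#ᶜ-missesSome (_∈? V v) (avoids? missing? S) (avoids-independent V disjoint))
  degree : ∀ v → length (filter (λ u → V v meets? V u) (allFin m)) ≤ Δ
  degree v = ≤-trans (≤-reflexive (length-filter-tabulate (λ u → V v meets? V u) id)) (meets≤Δ v)
  instance
    [1+j]^d≢0 : NonZero (suc j ^ d)
    [1+j]^d≢0 = m^n≢0 (suc j) d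
    [1+j]^n≢0 : NonZero (suc j ^ n)
    [1+j]^n≢0 = m^n≢0 (suc j) n
  open LocalLemma {N = suc j ^ n} (λ v → missing? v ∘ finToFun) (λ v u → V v meets? V u)
    (suc j * j ^ d) (suc j ^ d) Δ 4*[k*j^d*Δ]≤k^d rare
  colouring : ∃ (Avoids (λ v → MissesSome (suc j) (_∈ V v) ∘ finToFun) (allFin m))
  colouring = all-avoidable (allFin m) degree
  φ : Colouring (suc j) n
  φ = finToFun (proj₁ colouring)
  φ-avoids : Avoids (λ v → MissesSome (suc j) (_∈ V v)) (allFin m) φ
  φ-avoids = proj₂ colouring

-- Walks and paths

<-distinct⇒injective : ∀ {L} {f : ℕ → X} → (∀ {s t} → s < t → t < L → f s ≢ f t) →
                       Injective _≡_ _≡_ (f ∘ toℕ {L})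
<-distinct⇒injective distinct {s} {t} fs≡ft with <-cmp (toℕ s) (toℕ t)
... | tri< s<t _ _ = contradiction fs≡ft (distinct s<t (toℕ<n t))
... | tri≈ _ s≡t _ = toℕ-injective s≡t
... | tri> _ _ t<s = contradiction (sym fs≡ft) (distinct t<s (toℕ<n s))

module _ (D : Digraph n) where

  IsWalk : (ℕ → Fin n) → Set
  IsWalk w = ∀ t → T (arc D (w t) (w (suc t)))

  GirthAtLeast : ℕ → Set
  GirthAtLeast g = ∀ k → HasCycleOfLength D k → g ≤ k

  Rainbow : (Fin n → Fin k) → Set
  Rainbow φ = ∀ v i → ∃ λ w → T (arc D v w) × φ w ≡ i

  walk⇒path : ∀ {w L} → IsWalk w → (∀ {s t} → s < t → t ≤ L → w s ≢ w t) → IsPath D L (w ∘ toℕ)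
  walk⇒path {w} walk distinct = <-distinct⇒injective (λ s<t t<1+L → distinct s<t (≤-pred t<1+L))
    , λ i → subst (λ t → T (arc D (w t) (w (suc (toℕ i))))) (sym (toℕ-inject₁ i)) (walk (toℕ i))

  NoReturnBefore : ℕ → Set
  NoReturnBefore g = ∀ m → suc m < g → ∀ {w} → IsWalk w → w 0 ≢ w (suc m)

  no-return⇒distinct : ∀ {g w} → NoReturnBefore g → IsWalk w → ∀ {s t} → s < t → t < g + s → w s ≢ w t
  no-return⇒distinct {g} {w} no-return walk {s} s<t t<g+s ws≡wt with m≤n⇒∃[o]m+o≡n s<t
  ... | m , refl = no-return m (+-cancelʳ-< s (suc m) g (subst (_< g + s) (cong suc (+-comm s m)) t<g+s))
                     {λ t → w (t + s)} (λ t → walk (t + s)) (trans ws≡wt (cong (w ∘ suc) (+-comm s m)))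

  -- By induction on m the vertices w 0, …, w m are distinct, so that a return at time 1 + m closes a cycle.
  girth⇒no-return : ∀ {g} → GirthAtLeast g → NoReturnBefore g
  girth⇒no-return {g} girth = <-rec _ λ m no-return 1+m<g {w} walk w0≡w[1+m] →
    let no-shorter-return : NoReturnBefore (suc m)
        no-shorter-return = λ o 1+o<1+m → no-return (≤-pred 1+o<1+m) (<-trans 1+o<1+m 1+m<g)
        injective , arcs = walk⇒path walk λ {s} s<t t≤m →
          no-return⇒distinct no-shorter-return walk s<t (s≤s (≤-trans t≤m (m≤m+n m s)))
        closing = subst₂ (λ t v → T (arc D (w t) v)) (sym (toℕ-fromℕ m)) (sym w0≡w[1+m]) (walk m)
    in <⇒≱ 1+m<g (girth (suc m) (w ∘ toℕ , injective , arcs , closing))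

  rainbow⇒walk : {φ : Fin n → Fin k} → Rainbow φ → Fin n → (c : ℕ → Fin k) →
                 ∃ λ w → IsWalk w × (∀ t → φ (w t) ≡ c t)
  rainbow⇒walk {φ = φ} rainbow v c = w , walk , coloured
    where
    w : ℕ → Fin n
    w zero    = proj₁ (rainbow v (c 0))
    w (suc t) = proj₁ (rainbow (w t) (c (suc t)))
    walk : IsWalk w
    walk t = proj₁ (proj₂ (rainbow (w t) (c (suc t))))
    coloured : ∀ t → φ (w t) ≡ c t
    coloured zero    = proj₂ (proj₂ (rainbow v (c 0)))
    coloured (suc t) = proj₂ (proj₂ (rainbow (w t) (c (suc t))))

  rainbow⇒path : ∀ {g} .{{_ : NonZero g}} .{{_ : NonZero k}} {φ : Fin n → Fin k} →
                 Rainbow φ → GirthAtLeast g → Fin n → ∀ L → L < k * g → HasPath D L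
  rainbow⇒path {k = k} {g} {φ} rainbow girth v L L<kg = w ∘ toℕ , walk⇒path walk λ {s} {t} s<t t≤L ws≡wt →
    no-return⇒distinct (girth⇒no-return girth) walk s<t
      (m/o≡n/o⇒n<o+m s t g (same-block (≤-trans (<⇒≤ s<t) t≤L) t≤L ws≡wt)) ws≡wt
    where
    block : ℕ → Fin k
    block t = (t / g) mod k
    toℕ-block : ∀ {t} → t ≤ L → toℕ (block t) ≡ t / g
    toℕ-block t≤L = trans (toℕ-fromℕ< _) (m<n⇒m%n≡m (m<n*o⇒m/o<n (≤-<-trans t≤L L<kg)))
    block-walk : ∃ λ w → IsWalk w × (∀ t → φ (w t) ≡ block t)
    block-walk = rainbow⇒walk rainbow v block
    w : ℕ → Fin n
    w = proj₁ block-walk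
    walk : IsWalk w
    walk = proj₁ (proj₂ block-walk)
    same-block : ∀ {s t} → s ≤ L → t ≤ L → w s ≡ w t → s / g ≡ t / g
    same-block {s} {t} s≤L t≤L ws≡wt = begin
      s / g           ≡⟨ toℕ-block s≤L ⟨
      toℕ (block s)   ≡⟨ cong toℕ (proj₂ (proj₂ block-walk) s) ⟨
      toℕ (φ (w s))   ≡⟨ cong (toℕ ∘ φ) ws≡wt ⟩
      toℕ (φ (w t))   ≡⟨ cong toℕ (proj₂ (proj₂ block-walk) t) ⟩
      toℕ (block t)   ≡⟨ toℕ-block t≤L ⟩
      t / g           ∎
      where open ≡-Reasoning

  outdeg-# : ∀ v → outdeg D v ≡ # (λ w → T? (arc D v w))
  outdeg-# v = sum-allFin (λ w → indicator (T? (arc D v w)))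

  indeg-# : ∀ v → indeg D v ≡ # (λ u → T? (arc D u v))
  indeg-# v = sum-allFin (λ u → indicator (T? (arc D u v)))

  degrees⇒rainbow : ∀ {d K j} .{{_ : NonZero (d * K)}} → (∀ v → d ≤ outdeg D v) → (∀ v → indeg D v ≤ K) →
                    4 * (suc j * j ^ d * (d * K)) ≤ suc j ^ d → ∃ λ (φ : Fin n → Fin (suc j)) → Rainbow φ
  degrees⇒rainbow {d} {K} d≤outdeg indeg≤K rare =
    let φ , hits = rainbow-colouring V |V|≡d (#-meets V |V|≡d indegree≤K) rare
    in φ , λ v i → let w , w∈V , φw≡i = hits v i in w , V⊆out v w∈V , φw≡i
    where
    trimmed : ∀ v → ∃ λ V → # (_∈? V) ≡ d × (∀ {w} → w ∈ V → T (arc D v w))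
    trimmed v = subset-of-size (λ w → T? (arc D v w)) d (subst (d ≤_) (outdeg-# v) (d≤outdeg v))
    V : Fin n → Subset n
    V v = proj₁ (trimmed v)
    |V|≡d : ∀ v → # (_∈? V v) ≡ d
    |V|≡d v = proj₁ (proj₂ (trimmed v))
    V⊆out : ∀ v {w} → w ∈ V v → T (arc D v w)
    V⊆out v = proj₂ (proj₂ (trimmed v))
    indegree≤K : ∀ w → # (λ u → w ∈? V u) ≤ K
    indegree≤K w = begin
      # (λ u → w ∈? V u)          ≤⟨ #-mono (λ u → w ∈? V u) (λ u → T? (arc D u w)) (λ {u} → V⊆out u) ⟩
      # (λ u → T? (arc D u w))    ≡⟨ indeg-# w ⟨
      indeg D w                   ≤⟨ indeg≤K w ⟩
      K                           ∎
      where open ≤-Reasoning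

  arc⇒path : ∀ {v w} → w ≢ v → T (arc D v w) → HasPath D 1
  arc⇒path {v} {w} w≢v vw = Vec.lookup (v ∷ w ∷ []ᵛ) , injective , λ { zero → vw }
    where
    injective : Injective _≡_ _≡_ (Vec.lookup (v ∷ w ∷ []ᵛ))
    injective {zero}     {zero}     _  = refl
    injective {zero}     {suc zero} eq = contradiction (sym eq) w≢v
    injective {suc zero} {zero}     eq = contradiction eq w≢v
    injective {suc zero} {suc zero} _  = refl

  -- A path with N vertices has only N - 1 arcs, which is less than N / 2 for N = 1.
  path-of-length≥half : ∀ N → HasPath D 1 → (∀ L → L < N → HasPath D L) → ∃ λ L → HasPath D L × N ≤ 2 * L
  path-of-length≥half zero          arcPath _     = 1 , arcPath , z≤n
  path-of-length≥half (suc zero)    arcPath _     = 1 , arcPath , s≤s z≤n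
  path-of-length≥half (suc (suc N)) _       paths = suc N , paths (suc N) ≤-refl ,
    s≤s (≤-trans (m≤n+m (suc N) N) (+-monoʳ-≤ N (m≤m+n (suc N) 0)))

long-path : ∀ a {d n g} (D : Digraph n) → 2 ≤ d → (∀ v → d ≤ outdeg D v) → (∀ v → indeg D v ≤ 2 ^ a * d) →
            Girth D g → ∃ λ L → HasPath D L × d * g ≤ 2 * (8 + a) * (⌊log₂ d ⌋ * L)
long-path a         {g = zero}      D 2≤d d≤outdeg indeg≤2^a*d (() , _)
long-path a {d} {n} {g = g@(suc _)} D 2≤d d≤outdeg indeg≤2^a*d ((cycle , _) , girth) =
  let j , d≤[1+j]*t , rare = number-of-colours a 2≤d
      φ , rainbow = degrees⇒rainbow D d≤outdeg indeg≤2^a*d rare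
      w , w≢v , vw = another-element (λ w → T? (arc D v w)) 2≤outdeg v
      L , path , [1+j]*g≤2L =
        path-of-length≥half D (suc j * g) (arc⇒path D w≢v vw) (rainbow⇒path D rainbow girth v)
  in L , path , bound {suc j} {L} d≤[1+j]*t [1+j]*g≤2L
  where
  v : Fin n
  v = cycle zero
  2≤outdeg : 2 ≤ # (λ w → T? (arc D v w))
  2≤outdeg = ≤-trans 2≤d (subst (d ≤_) (outdeg-# D v) (d≤outdeg v))
  ℓ : ℕ
  ℓ = ⌊log₂ d ⌋
  instance
    d≢0 : NonZero d
    d≢0 = >-nonZero (<⇒≤ 2≤d)
    2^a*d≢0 : NonZero (2 ^ a * d)
    2^a*d≢0 = m*n≢0 (2 ^ a) d {{m^n≢0 2 a}}
    d*[2^a*d]≢0 : NonZero (d * (2 ^ a * d))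
    d*[2^a*d]≢0 = m*n≢0 d (2 ^ a * d)
  bound : ∀ {k L} → d ≤ k * ((8 + a) * ℓ) → k * g ≤ 2 * L → d * g ≤ 2 * (8 + a) * (ℓ * L)
  bound {k} {L} d≤kt kg≤2L = begin
    d * g                       ≤⟨ *-monoˡ-≤ g d≤kt ⟩
    k * ((8 + a) * ℓ) * g       ≡⟨ regroup k (8 + a) ℓ g ⟩
    (8 + a) * ℓ * (k * g)       ≤⟨ *-monoʳ-≤ ((8 + a) * ℓ) kg≤2L ⟩
    (8 + a) * ℓ * (2 * L)       ≡⟨ regroup′ (8 + a) ℓ L ⟩
    2 * (8 + a) * (ℓ * L)       ∎
    where
    open ≤-Reasoning
    regroup : ∀ k b ℓ g → k * (b * ℓ) * g ≡ b * ℓ * (k * g)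
    regroup = solve-∀
    regroup′ : ∀ b ℓ L → b * ℓ * (2 * L) ≡ 2 * b * (ℓ * L)
    regroup′ = solve-∀

i≤+∣i∣ : ∀ i → i ℤ.≤ ℤ.+ ∣ i ∣
i≤+∣i∣ (ℤ.+ _)  = ℤ.≤-refl
i≤+∣i∣ -[1+ _ ] = ℤ.-≤+

toℚᵘ-ℕtoℚ : ∀ m → ℚ.toℚᵘ (ℕtoℚ m) ℚᵘ.≃ mkℚᵘ (ℤ.+ m) 0
toℚᵘ-ℕtoℚ m = ℚ.toℚᵘ-fromℚᵘ (mkℚᵘ (ℤ.+ m) 0)

m≤C*d⇒m≤∣↥C∣*d : ∀ C {m d} → ℕtoℚ m ℚ.≤ C ℚ.* ℕtoℚ d → m ≤ ∣ ↥ C ∣ * d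
m≤C*d⇒m≤∣↥C∣*d C@record{} {m} {d} m≤C*d = ℤ.drop‿+≤+ (begin
  ℤ.+ m                     ≤⟨ ℤ.+≤+ (m≤m*n m (↧ₙ C*d)) ⟩
  ℤ.+ (m * ↧ₙ C*d)          ≡⟨ ℤ.pos-* m (↧ₙ C*d) ⟩
  ℤ.+ m ℤ.* ℤ.+ ↧ₙ C*d      ≤⟨ ℚᵘ.drop-*≤* m≤C*dᵘ ⟩
  ↥ C ℤ.* ℤ.+ d ℤ.* ℤ.+ 1   ≡⟨ ℤ.*-identityʳ (↥ C ℤ.* ℤ.+ d) ⟩
  ↥ C ℤ.* ℤ.+ d             ≤⟨ ℤ.*-monoʳ-≤-nonNeg (ℤ.+ d) (i≤+∣i∣ (↥ C)) ⟩
  ℤ.+ ∣ ↥ C ∣ ℤ.* ℤ.+ d     ≡⟨ ℤ.pos-* ∣ ↥ C ∣ d ⟨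
  ℤ.+ (∣ ↥ C ∣ * d)         ∎)
  where
  open ℤ.≤-Reasoning
  C*d : ℚᵘ.ℚᵘ
  C*d = ℚ.toℚᵘ C ℚᵘ.* mkℚᵘ (ℤ.+ d) 0
  m≤C*dᵘ : mkℚᵘ (ℤ.+ m) 0 ℚᵘ.≤ C*d
  m≤C*dᵘ = ℚᵘ.≤-respˡ-≃ (toℚᵘ-ℕtoℚ m) (ℚᵘ.≤-respʳ-≃ C*dᵘ≃C*d (ℚ.toℚᵘ-mono-≤ m≤C*d))
    where
    C*dᵘ≃C*d : ℚ.toℚᵘ (C ℚ.* ℕtoℚ d) ℚᵘ.≃ C*d
    C*dᵘ≃C*d = ℚᵘ.≃-trans (ℚ.toℚᵘ-homo-* C (ℕtoℚ d)) (ℚᵘ.*-congˡ {ℚ.toℚᵘ C} (toℚᵘ-ℕtoℚ d))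

theorem3 : ∀ (C : ℚ) → 0ℚ <ℚ C →
    Σ ℕ λ p → Σ ℕ λ q → (0 < q) × (q < p) ×
      (∀ (d n g : ℕ) (D : Digraph n) → 2 ≤ d → Regular C d D → Girth D g →
        Σ ℕ λ L → HasPath D L × (p ^ (d * g) ≤ (d ^ L) * (q ^ (d * g))))
theorem3 C _ = suc q , q , z<s , ≤-refl , bound
  where
  a m q : ℕ
  a = ∣ ↥ C ∣
  m = 2 * (8 + a)
  q = 2 * m
  bound : ∀ (d n g : ℕ) (D : Digraph n) → 2 ≤ d → Regular C d D → Girth D g →
    Σ ℕ λ L → HasPath D L × (suc q ^ (d * g) ≤ (d ^ L) * (q ^ (d * g)))
  bound d n g D 2≤d regular girth =
    let L , path , d*g≤m*ℓ*L = long-path a D 2≤d (proj₁ ∘ regular) indeg≤2^a*d girth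
    in L , path , (begin
      suc q ^ (d * g)
        ≤⟨ x^m≤c*y^m⇒x^e≤c^s*y^e m (⌊log₂ d ⌋ * L) (n≤1+n q) ([1+q]^m≤2*q^m q m (n≤1+n q)) d*g≤m*ℓ*L ⟩
      2 ^ (⌊log₂ d ⌋ * L) * q ^ (d * g)
        ≡⟨ cong (_* q ^ (d * g)) (^-*-assoc 2 ⌊log₂ d ⌋ L) ⟨
      (2 ^ ⌊log₂ d ⌋) ^ L * q ^ (d * g)
        ≤⟨ *-monoˡ-≤ (q ^ (d * g)) (^-monoˡ-≤ L (2^⌊log₂n⌋≤n d {{>-nonZero (<⇒≤ 2≤d)}})) ⟩
      d ^ L * q ^ (d * g) ∎)
    where
    open ≤-Reasoning
    indeg≤2^a*d : ∀ v → indeg D v ≤ 2 ^ a * d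
    indeg≤2^a*d v = ≤-trans (m≤C*d⇒m≤∣↥C∣*d C (proj₂ (regular v))) (*-monoˡ-≤ d (<⇒≤ (n<2^n a)))
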